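{- Let $k\ge1$, $n=3^k$, and $f=\mathrm{Maj}_3^{\circ k}\colon\mathbb F_2^n\to\{+1,-1\}$. Then for every $0\le d\le n$ and every linear subspace $A\le\mathbb F_2^n$ of dimension $d$, $$\sum_{S\in A}\hat f(S)^2\le\frac{4d}{n}.$$
   Context: Boolean values are written as $\pm1$ (bit $0\mapsto+1$, bit $1\mapsto-1$); $\mathrm{Maj}_3\colon\mathbb F_2^3\to\{+1,-1\}$ is the majority of three bits, with Fourier expansion $\mathrm{Maj}_3=\frac12(\chi_{\{1\}}+\chi_{\{2\}}+\chi_{\{3\}}-\chi_{\{1,2,3\}})$ where $\chi_S(x)=(-1)^{\sum_{i\in S}x_i}$. Composition: for $f\colon\mathbb F_2^a\to\{\pm1\}$ and $g\colon\mathbb F_2^m\to\{\pm1\}$, $(f\circ g)(x)=f(g(x_1,\dots,x_m),g(x_{m+1},\dots,x_{2m}),\dots,g(x_{m(a-1)+1},\dots,x_{ma}))$ (values of $g$ converted back to bits). $\mathrm{Maj}_3^{\circ1}=\mathrm{Maj}_3$ and $\mathrm{Maj}_3^{\circ k}=\mathrm{Maj}_3\circ\mathrm{Maj}_3^{\circ(k-1)}$. Fourier coefficients: $\hat f(S)=\mathbb E_{x\sim U(\mathbb F_2^n)}[f(x)(-1)^{S\cdot x}]$. -}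

module Defs where

open import Data.Bool using (Bool; true; false; if_then_else_; _xor_; _∧_; _∨_; not)
open import Data.Nat as ℕ using (ℕ; zero; suc; _^_)
open import Data.Nat.Properties using (m^n≢0)
open import Data.Integer as ℤ using (ℤ; +_; -_)
open import Data.Rational as ℚ using (ℚ; 0ℚ)
open import Data.Vec using (Vec; []; _∷_; head; splitAt; zipWith; replicate)
open import Data.List using (List; []; _∷_; map; concatMap; filter; foldr)
open import Data.Product using (Σ; ∃; _×_; _,_)
open import Relation.Binary.PropositionalEquality using (_≡_)
open import Relation.Nullary.Decidable using (does)
open import Data.Bool.Properties using (T?)
open import Function using (_⇔_)

-- Points of F_2^n: bit false = 0, bit true = 1.
F2^ : ℕ → Set
F2^ n = Vec Bool n

allVecs : (n : ℕ) → List (F2^ n)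
allVecs zero = [] ∷ []
allVecs (suc n) = concatMap (λ v → (false ∷ v) ∷ (true ∷ v) ∷ []) (allVecs n)

_⊕_ : ∀ {n} → F2^ n → F2^ n → F2^ n
_⊕_ = zipWith _xor_

𝟘 : ∀ {n} → F2^ n
𝟘 = replicate _ false

dot : ∀ {n} → F2^ n → F2^ n → Bool
dot [] [] = false
dot (s ∷ ss) (x ∷ xs) = (s ∧ x) xor dot ss xs

sign : Bool → ℤ
sign b = if b then - (+ 1) else + 1

χ : ∀ {n} → F2^ n → F2^ n → ℤ
χ S x = sign (dot S x)

maj3 : Bool → Bool → Bool → Bool
maj3 a b c = (a ∧ b) ∨ (b ∧ c) ∨ (a ∧ c)

-- Maj_3^{∘k} as a bit-valued function on 3^k bits; Maj_3^{∘0} is the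
-- identity on one bit, so Maj_3^{∘1} = Maj_3 and
-- Maj_3^{∘(k+1)} = Maj_3 ∘ Maj_3^{∘k} (blocks of consecutive coordinates).
majIter : (k : ℕ) → F2^ (3 ^ k) → Bool
majIter zero x = head x
majIter (suc k) x with splitAt (3 ^ k) x
... | x₁ , rest , _ with splitAt (3 ^ k) rest
...   | x₂ , rest' , _ with splitAt (3 ^ k) rest'
...     | x₃ , _ , _ = maj3 (majIter k x₁) (majIter k x₂) (majIter k x₃)

MajK : (k : ℕ) → F2^ (3 ^ k) → ℤ
MajK k x = sign (majIter k x)

sumℚ : List ℚ → ℚ
sumℚ = foldr ℚ._+_ 0ℚ

sumℤ : List ℤ → ℤ
sumℤ = foldr ℤ._+_ (+ 0)

fourier : ∀ {n} → (F2^ n → ℤ) → F2^ n → ℚ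
fourier {n} f S =
  ℚ._/_ (sumℤ (map (λ x → f x ℤ.* χ S x) (allVecs n))) (2 ^ n) {{m^n≢0 2 n}}

combo : ∀ {n d} → Vec (F2^ n) d → F2^ d → F2^ n
combo [] [] = 𝟘
combo (v ∷ vs) (c ∷ cs) = (if c then v else 𝟘) ⊕ combo vs cs

record IsSubspace {n : ℕ} (A : F2^ n → Bool) : Set where
  field
    zero∈ : A 𝟘 ≡ true
    ⊕-closed : ∀ x y → A x ≡ true → A y ≡ true → A (x ⊕ y) ≡ true

HasDim : ∀ {n} → (F2^ n → Bool) → ℕ → Set
HasDim {n} A d =
  Σ (Vec (F2^ n) d) λ B →
    (∀ c → combo B c ≡ 𝟘 → c ≡ 𝟘) ×
    (∀ x → (A x ≡ true) ⇔ (∃ λ c → combo B c ≡ x))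

weightOn : ∀ {n} → (F2^ n → ℤ) → (F2^ n → Bool) → ℚ
weightOn {n} f A =
  sumℚ (map (λ S → fourier f S ℚ.* fourier f S) (filter (λ S → T? (A S)) (allVecs n)))

bound : (k d : ℕ) → ℚ
bound k d = ℚ._/_ (+ (4 ℕ.* d)) (3 ^ k) {{m^n≢0 3 k}}

{-# OPTIONS --safe #-}
module Submission where

open import Defs
open import Algebra.Bundles using (CommutativeSemiring)
import Algebra.Properties.CommutativeSemigroup as CommutativeSemigroupProperties
open import Data.Bool as Bool using (Bool; true; false; if_then_else_; _∧_; _∨_; _xor_)
open import Data.Bool.Properties using (T?; xor-assoc; xor-comm; xor-same; xor-identityˡ; xor-identityʳ)
open import Data.Integer as ℤ using (ℤ; +_; -_; ∣_∣)
import Data.Integer.Properties as ℤ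
import Data.Integer.Tactic.RingSolver as ℤ-Ring
open import Data.List using (List; []; _∷_; map; concatMap; filter)
open import Data.List.Properties using (map-cong)
open import Data.Nat using (ℕ; zero; suc; _+_; _*_; _^_; _≤_; _<_; z≤n; s≤s; NonZero)
open import Data.Nat.Properties
import Data.Nat.Tactic.RingSolver as ℕ-Ring
open import Data.Product using (∃; _×_; _,_; proj₁; proj₂)
open import Data.Rational as ℚ using (ℚ; toℚᵘ)
import Data.Rational.Properties as ℚ
import Data.Rational.Unnormalised as ℚᵘ
import Data.Rational.Unnormalised.Properties as ℚᵘ
open import Data.Sum using (_⊎_; inj₁; inj₂; [_,_]′)
open import Data.Vec using (Vec; []; _∷_; _++_; splitAt; tail)
open import Data.Vec.Properties using (zipWith-assoc; zipWith-comm; zipWith-identityˡ; zipWith-identityʳ; zipWith-++; ≡-dec)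
open import Function using (_∘_; id; Equivalence)
open import Relation.Binary.PropositionalEquality
open import Relation.Nullary using (yes; no; does; contradiction)

-- Let m = 3ᵏ, let f be the k-fold iterate, and let S be drawn with probability
-- f̂(S)². The expansion Maj₃ = ½(χ₁ + χ₂ + χ₃ − χ₁₂₃) and f̂(0) = 0 say that the
-- law for k + 1 is: with probability ¼ each, S = (S₁,0,0), (0,S₂,0), (0,0,S₃) or
-- (S₁,S₂,S₃), where the Sᵢ are independent with the law for k.
--
-- Induction on k gives P(S ∈ A) ≤ d/3ᵏ, four times better than required. Let Aᵢ
-- be the intersection of A with the i-th axis and dᵢ = dim Aᵢ, so that
-- d₁ + d₂ + d₃ ≤ d. The first three cases contribute at most (d₁ + d₂ + d₃)/4m.
-- In the fourth, once two of the Sⱼ are fixed, the remaining Sᵢ lies in a coset of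
-- Aᵢ, hence in a subspace of dimension dᵢ + 1, so the probability is at most
-- (dᵢ + 1)/m; if d₁ + d₂ + d₃ = d, then A is the direct sum of the Aᵢ and the
-- bound is dᵢ/m. Averaging over i, 3(d₁ + d₂ + d₃) + (d₁ + d₂ + d₃) + 3ε ≤ 4d,
-- where ε = 0 for direct sums and ε = 1 otherwise.

-- The vector space F₂ⁿ

⊕-comm : ∀ {n} (x y : F2^ n) → x ⊕ y ≡ y ⊕ x
⊕-comm = zipWith-comm xor-comm

⊕-assoc : ∀ {n} (x y z : F2^ n) → (x ⊕ y) ⊕ z ≡ x ⊕ (y ⊕ z)
⊕-assoc = zipWith-assoc xor-assoc

⊕-identityˡ : ∀ {n} (x : F2^ n) → 𝟘 ⊕ x ≡ x
⊕-identityˡ = zipWith-identityˡ xor-identityˡ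

⊕-identityʳ : ∀ {n} (x : F2^ n) → x ⊕ 𝟘 ≡ x
⊕-identityʳ = zipWith-identityʳ xor-identityʳ

⊕-self : ∀ {n} (x : F2^ n) → x ⊕ x ≡ 𝟘
⊕-self []       = refl
⊕-self (b ∷ x) = cong₂ _∷_ (xor-same b) (⊕-self x)

⊕-cancelʳ : ∀ {n} (x y : F2^ n) → (x ⊕ y) ⊕ y ≡ x
⊕-cancelʳ x y = trans (⊕-assoc x y y) (trans (cong (x ⊕_) (⊕-self y)) (⊕-identityʳ x))

⊕-swapʳ : ∀ {n} (x y z : F2^ n) → (x ⊕ y) ⊕ z ≡ (x ⊕ z) ⊕ y
⊕-swapʳ x y z =
  trans (⊕-assoc x y z) (trans (cong (x ⊕_) (⊕-comm y z)) (sym (⊕-assoc x z y)))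

-- Subsets of F₂ⁿ

Sub : ℕ → Set
Sub n = F2^ n → Bool

infix 4 _∈_ _⊆_

_∈_ : ∀ {n} → F2^ n → Sub n → Set
x ∈ A = A x ≡ true

_⊆_ : ∀ {n} → Sub n → Sub n → Set
A ⊆ B = ∀ x → x ∈ A → x ∈ B

∨-introˡ : ∀ {a} b → a ≡ true → a ∨ b ≡ true
∨-introˡ b refl = refl

∨-introʳ : ∀ a {b} → b ≡ true → a ∨ b ≡ true
∨-introʳ true  _ = refl
∨-introʳ false p = p

∨-elim : ∀ a {b} → a ∨ b ≡ true → a ≡ true ⊎ b ≡ true
∨-elim true  _ = inj₁ refl
∨-elim false p = inj₂ p

-- Existence over the cube as a Boolean, so that a projection of a Boolean subset is again a `Sub`
-- and `dim` computes by recursion on coordinates.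
nonempty : ∀ {n} → Sub n → Bool
nonempty {zero}  A = A []
nonempty {suc n} A = nonempty (A ∘ (false ∷_)) ∨ nonempty (A ∘ (true ∷_))

nonempty-intro : ∀ {n} (A : Sub n) x → x ∈ A → nonempty A ≡ true
nonempty-intro A []          p = p
nonempty-intro A (false ∷ x) p = ∨-introˡ _ (nonempty-intro (A ∘ (false ∷_)) x p)
nonempty-intro A (true ∷ x)  p =
  ∨-introʳ (nonempty (A ∘ (false ∷_))) (nonempty-intro (A ∘ (true ∷_)) x p)

nonempty-elim : ∀ {n} (A : Sub n) → nonempty A ≡ true → ∃ λ x → x ∈ A
nonempty-elim {zero}  A p = [] , p
nonempty-elim {suc n} A p with ∨-elim (nonempty (A ∘ (false ∷_))) p
... | inj₁ q = let x , r = nonempty-elim (A ∘ (false ∷_)) q in false ∷ x , r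
... | inj₂ q = let x , r = nonempty-elim (A ∘ (true ∷_)) q in true ∷ x , r

nonempty-++ : ∀ a {b} (A : Sub (a + b)) →
  nonempty A ≡ nonempty {a} (λ s → nonempty (λ t → A (s ++ t)))
nonempty-++ zero    A = refl
nonempty-++ (suc a) A =
  cong₂ _∨_ (nonempty-++ a (A ∘ (false ∷_))) (nonempty-++ a (A ∘ (true ∷_)))

-- Dimension

⟦_⟧ : Bool → ℕ
⟦ b ⟧ = if b then 1 else 0

⟦⟧≤1 : ∀ b → ⟦ b ⟧ ≤ 1
⟦⟧≤1 true  = ≤-refl
⟦⟧≤1 false = z≤n

⟦⟧-mono : ∀ {a b} → (a ≡ true → b ≡ true) → ⟦ a ⟧ ≤ ⟦ b ⟧
⟦⟧-mono {false} h = z≤n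
⟦⟧-mono {true}  h rewrite h refl = ≤-refl

⟦⟧-reflect : ∀ {a b} → ⟦ b ⟧ ≤ ⟦ a ⟧ → b ≡ true → a ≡ true
⟦⟧-reflect {true} _ _ = refl
⟦⟧-reflect {false} () refl

-- Gaussian elimination along the coordinates: for a subspace this is the
-- number of pivots, i.e. the dimension; for other subsets it is a junk value.
dim : ∀ {n} → Sub n → ℕ
dim {zero}  A = 0
dim {suc n} A = ⟦ nonempty (A ∘ (true ∷_)) ⟧ + dim (A ∘ (false ∷_))

nonempty-mono : ∀ {n} (A B : Sub n) → A ⊆ B → nonempty A ≡ true → nonempty B ≡ true
nonempty-mono A B A⊆B p =
  let x , q = nonempty-elim A p in nonempty-intro B x (A⊆B x q)

-- Each pivot indicator is monotone in the set, so arbitrary subsets can be compared with subspaces.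
dim-mono : ∀ {n} (A B : Sub n) → A ⊆ B → dim A ≤ dim B
dim-mono {zero}  A B A⊆B = z≤n
dim-mono {suc n} A B A⊆B = +-mono-≤
  (⟦⟧-mono (nonempty-mono (A ∘ (true ∷_)) (B ∘ (true ∷_)) (A⊆B ∘ (true ∷_))))
  (dim-mono (A ∘ (false ∷_)) (B ∘ (false ∷_)) (A⊆B ∘ (false ∷_)))

-- Rank–nullity for the projection to the first a coordinates.
dim-++ : ∀ a {b} (A : Sub (a + b)) →
  dim A ≡ dim {a} (λ s → nonempty (λ t → A (s ++ t))) + dim (λ t → A (𝟘 {a} ++ t))
dim-++ zero    A = refl
dim-++ (suc a) A = trans
  (cong₂ _+_ (cong ⟦_⟧ (nonempty-++ a (A ∘ (true ∷_)))) (dim-++ a (A ∘ (false ∷_))))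
  (sym (+-assoc ⟦ nonempty {a} (λ s → nonempty (λ t → A (true ∷ s ++ t))) ⟧ _ _))

preimage-isSubspace : ∀ {a b} {A : Sub b} (ι : F2^ a → F2^ b) → ι 𝟘 ≡ 𝟘 →
  (∀ x y → ι x ⊕ ι y ≡ ι (x ⊕ y)) → IsSubspace A → IsSubspace (A ∘ ι)
preimage-isSubspace {A = A} ι ι-𝟘 ι-⊕ sA = record
  { zero∈    = trans (cong A ι-𝟘) (IsSubspace.zero∈ sA)
  ; ⊕-closed = λ x y p q →
      trans (cong A (sym (ι-⊕ x y))) (IsSubspace.⊕-closed sA (ι x) (ι y) p q)
  }

kernel-isSubspace : ∀ {n} {A : Sub (suc n)} → IsSubspace A → IsSubspace (A ∘ (false ∷_))
kernel-isSubspace = preimage-isSubspace (false ∷_) refl (λ _ _ → refl)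

𝟘-++ : ∀ a {b} → 𝟘 {a} ++ 𝟘 {b} ≡ 𝟘
𝟘-++ zero    = refl
𝟘-++ (suc a) = cong (false ∷_) (𝟘-++ a)

projection-isSubspace : ∀ a {b} {A : Sub (a + b)} → IsSubspace A →
  IsSubspace {a} (λ s → nonempty (λ t → A (s ++ t)))
projection-isSubspace a {b} {A} sA = record
  { zero∈    = nonempty-intro (λ t → A (𝟘 {a} ++ t)) 𝟘
                 (trans (cong A (𝟘-++ a)) (IsSubspace.zero∈ sA))
  ; ⊕-closed = λ x y p q →
      let s , s∈ = nonempty-elim (λ t → A (x ++ t)) p
          t , t∈ = nonempty-elim (λ t → A (y ++ t)) q
      in nonempty-intro (λ t → A ((x ⊕ y) ++ t)) (s ⊕ t)
           (trans (cong A (sym (zipWith-++ _xor_ x s y t)))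
                  (IsSubspace.⊕-closed sA (x ++ s) (y ++ t) s∈ t∈))
  }

-- The inclusion bounds both summands of `dim A` by those of `dim B`, so the reverse inequality
-- forces them to agree one by one. The kernels then coincide by recursion, and a pivot vector `u`
-- of `A` moves any vector of `B` with leading bit 1 into the kernel.
⊆-dim-≤⇒⊇ : ∀ {n} {A B : Sub n} → IsSubspace A → IsSubspace B →
  A ⊆ B → dim B ≤ dim A → B ⊆ A
⊆-dim-≤⇒⊇ sA sB A⊆B le [] p = IsSubspace.zero∈ sA
⊆-dim-≤⇒⊇ {suc n} {A} {B} sA sB A⊆B le = go
  where
  A₀ A₁ B₀ B₁ : Sub n
  A₀ = A ∘ (false ∷_)
  A₁ = A ∘ (true ∷_)
  B₀ = B ∘ (false ∷_)
  B₁ = B ∘ (true ∷_)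

  pivot : ⟦ nonempty A₁ ⟧ ≤ ⟦ nonempty B₁ ⟧
  pivot = ⟦⟧-mono (nonempty-mono A₁ B₁ (A⊆B ∘ (true ∷_)))

  kernel : B₀ ⊆ A₀
  kernel = ⊆-dim-≤⇒⊇ (kernel-isSubspace sA) (kernel-isSubspace sB) (A⊆B ∘ (false ∷_))
    (+-cancelˡ-≤ ⟦ nonempty B₁ ⟧ _ _ (≤-trans le (+-monoˡ-≤ (dim A₀) pivot)))

  pivot′ : ⟦ nonempty B₁ ⟧ ≤ ⟦ nonempty A₁ ⟧
  pivot′ = +-cancelʳ-≤ (dim A₀) _ _
    (≤-trans (+-monoʳ-≤ ⟦ nonempty B₁ ⟧ (dim-mono A₀ B₀ (A⊆B ∘ (false ∷_)))) le)

  go : B ⊆ A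
  go (false ∷ x) p = kernel x p
  go (true ∷ x)  p with nonempty-elim A₁ (⟦⟧-reflect pivot′ (nonempty-intro B₁ x p))
  ... | u , u∈ = subst (_∈ A) (cong (true ∷_) (⊕-cancelʳ x u))
    (IsSubspace.⊕-closed sA (false ∷ (x ⊕ u)) (true ∷ u)
      (kernel (x ⊕ u) (IsSubspace.⊕-closed sB (true ∷ x) (true ∷ u) p (A⊆B (true ∷ u) u∈)))
      u∈)

-- Recursion on the leading bit of `v`. The surplus of one is charged to the first coordinate where
-- `v`, reduced by pivot vectors of `A`, has a 1 and `A` has no pivot.
dim-coset : ∀ {n} {A : Sub n} (B : Sub n) (v : F2^ n) → IsSubspace A →
  (∀ x → x ∈ B → x ∈ A ⊎ x ⊕ v ∈ A) → dim B ≤ suc (dim A)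
dim-coset B [] sA h = z≤n
dim-coset {A = A} B (false ∷ v) sA h = ≤-trans
  (+-mono-≤ (⟦⟧-mono pivot)
    (dim-coset (B ∘ (false ∷_)) v (kernel-isSubspace sA) (h ∘ (false ∷_))))
  (≤-reflexive (+-suc ⟦ nonempty (A ∘ (true ∷_)) ⟧ (dim (A ∘ (false ∷_)))))
  where
  pivot : nonempty (B ∘ (true ∷_)) ≡ true → nonempty (A ∘ (true ∷_)) ≡ true
  pivot p with nonempty-elim (B ∘ (true ∷_)) p
  ... | x , x∈ with h (true ∷ x) x∈
  ...   | inj₁ q = nonempty-intro (A ∘ (true ∷_)) x q
  ...   | inj₂ q = nonempty-intro (A ∘ (true ∷_)) (x ⊕ v) q
dim-coset {A = A} B (true ∷ v) sA h with nonempty (A ∘ (true ∷_)) in eq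
... | false = +-mono-≤ (⟦⟧≤1 (nonempty (B ∘ (true ∷_))))
  (dim-mono (B ∘ (false ∷_)) (A ∘ (false ∷_)) kernel)
  where
  kernel : B ∘ (false ∷_) ⊆ A ∘ (false ∷_)
  kernel x p with h (false ∷ x) p
  ... | inj₁ q = q
  ... | inj₂ q with trans (sym eq) (nonempty-intro (A ∘ (true ∷_)) (x ⊕ v) q)
  ...   | ()
-- Adding a pivot vector of `A` to `v` keeps its coset and clears its leading bit, which passes the
-- surplus on to the kernel.
... | true with nonempty-elim (A ∘ (true ∷_)) eq
...   | u , u∈ = +-mono-≤ (⟦⟧≤1 (nonempty (B ∘ (true ∷_))))
  (dim-coset (B ∘ (false ∷_)) (v ⊕ u) (kernel-isSubspace sA) kernel)
  where
  kernel : ∀ x → x ∈ B ∘ (false ∷_) → x ∈ A ∘ (false ∷_) ⊎ x ⊕ (v ⊕ u) ∈ A ∘ (false ∷_)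
  kernel x p with h (false ∷ x) p
  ... | inj₁ q = inj₁ q
  ... | inj₂ q = inj₂ (subst (_∈ A) (cong (false ∷_) (⊕-assoc x v u))
    (IsSubspace.⊕-closed sA (true ∷ (x ⊕ v)) (true ∷ u) q u∈))

-- Over F₂ the only multiples of `v` are 0 and `v`, so for a subspace `A` the union with its
-- translate by `v` is the subspace generated by both.
extend : ∀ {n} → F2^ n → Sub n → Sub n
extend v A x = A x ∨ A (x ⊕ v)

extend-isSubspace : ∀ {n} {A : Sub n} v → IsSubspace A → IsSubspace (extend v A)
extend-isSubspace {A = A} v sA = record
  { zero∈    = ∨-introˡ _ zero∈
  ; ⊕-closed = λ x y p q → closed x y (∨-elim (A x) p) (∨-elim (A y) q)
  }
  where
  open IsSubspace sA
  closed : ∀ x y → x ∈ A ⊎ x ⊕ v ∈ A → y ∈ A ⊎ y ⊕ v ∈ A → x ⊕ y ∈ extend v A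
  closed x y (inj₁ p) (inj₁ q) = ∨-introˡ _ (⊕-closed x y p q)
  closed x y (inj₁ p) (inj₂ q) = ∨-introʳ (A (x ⊕ y))
    (subst (_∈ A) (sym (⊕-assoc x y v)) (⊕-closed x (y ⊕ v) p q))
  closed x y (inj₂ p) (inj₁ q) = ∨-introʳ (A (x ⊕ y))
    (subst (_∈ A) (⊕-swapʳ x v y) (⊕-closed (x ⊕ v) y p q))
  closed x y (inj₂ p) (inj₂ q) = ∨-introˡ _ (subst (_∈ A) eq (⊕-closed (x ⊕ v) (y ⊕ v) p q))
    where
    eq : (x ⊕ v) ⊕ (y ⊕ v) ≡ x ⊕ y
    eq = trans (sym (⊕-assoc (x ⊕ v) y v))
      (trans (cong (_⊕ v) (⊕-swapʳ x v y)) (⊕-cancelʳ (x ⊕ y) v))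

dim-extend : ∀ {n} {A : Sub n} v → IsSubspace A → dim (extend v A) ≤ suc (dim A)
dim-extend {A = A} v sA = dim-coset (extend v A) v sA (λ x → ∨-elim (A x))

-- Boolean counterpart of the image of `combo`, built by `extend` so that each vector adds at most
-- one to `dim`.
span : ∀ {n d} → Vec (F2^ n) d → Sub n
span []       x = does (≡-dec Bool._≟_ x 𝟘)
span (v ∷ vs)   = extend v (span vs)

𝟘∈span[] : ∀ n → 𝟘 {n} ∈ span []
𝟘∈span[] n with ≡-dec Bool._≟_ (𝟘 {n}) 𝟘
... | yes _ = refl
... | no ¬p = contradiction refl ¬p

span[]⇒𝟘 : ∀ {n} (x : F2^ n) → x ∈ span [] → x ≡ 𝟘
span[]⇒𝟘 x p with ≡-dec Bool._≟_ x 𝟘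
... | yes q = q
span[]⇒𝟘 x () | no _

span-isSubspace : ∀ {n d} (B : Vec (F2^ n) d) → IsSubspace (span B)
span-isSubspace {n} [] = record
  { zero∈    = 𝟘∈span[] n
  ; ⊕-closed = λ x y p q → subst (_∈ span [])
      (sym (trans (cong₂ _⊕_ (span[]⇒𝟘 x p) (span[]⇒𝟘 y q)) (⊕-identityˡ 𝟘))) (𝟘∈span[] n)
  }
span-isSubspace (v ∷ vs) = extend-isSubspace v (span-isSubspace vs)

combo∈span : ∀ {n d} (B : Vec (F2^ n) d) c → combo B c ∈ span B
combo∈span {n} [] []            = 𝟘∈span[] n
combo∈span (v ∷ vs) (false ∷ c) = ∨-introˡ _
  (subst (_∈ span vs) (sym (⊕-identityˡ (combo vs c))) (combo∈span vs c))
combo∈span (v ∷ vs) (true ∷ c)  = ∨-introʳ (span vs (v ⊕ combo vs c))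
  (subst (_∈ span vs) (sym (trans (cong (_⊕ v) (⊕-comm v _)) (⊕-cancelʳ _ v))) (combo∈span vs c))

dim-𝟘 : ∀ {n} (A : Sub n) → (∀ x → x ∈ A → x ≡ 𝟘) → dim A ≡ 0
dim-𝟘 {zero}  A h = refl
dim-𝟘 {suc n} A h with nonempty (A ∘ (true ∷_)) in eq
... | false = dim-𝟘 (A ∘ (false ∷_)) (λ x p → cong tail (h (false ∷ x) p))
... | true with nonempty-elim (A ∘ (true ∷_)) eq
...   | u , u∈ with h (true ∷ u) u∈
...     | ()

dim-span : ∀ {n d} (B : Vec (F2^ n) d) → dim (span B) ≤ d
dim-span {n} []   = ≤-reflexive (dim-𝟘 {n} (span []) span[]⇒𝟘)
dim-span (v ∷ vs) = ≤-trans (dim-extend v (span-isSubspace vs)) (s≤s (dim-span vs))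

-- `A` lies in the span of its basis. An upper bound is the direction required, because the estimate
-- of the mass grows with `dim`.
HasDim⇒dim≤ : ∀ {n d} (A : Sub n) → HasDim A d → dim A ≤ d
HasDim⇒dim≤ A (B , _ , spans) = ≤-trans (dim-mono A (span B) A⊆span) (dim-span B)
  where
  A⊆span : A ⊆ span B
  A⊆span x p with Equivalence.to (spans x) p
  ... | c , refl = combo∈span B c

-- The three blocks of F₂³ᵐ

-- The shape of 3 * m after unfolding, hence the trailing [].
join : ∀ {m} → F2^ m → F2^ m → F2^ m → F2^ (3 * m)
join x y z = x ++ (y ++ (z ++ []))

join-⊕ : ∀ {m} (x y z x′ y′ z′ : F2^ m) →
  join x y z ⊕ join x′ y′ z′ ≡ join (x ⊕ x′) (y ⊕ y′) (z ⊕ z′)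
join-⊕ x y z x′ y′ z′ =
  trans (zipWith-++ _xor_ x (y ++ (z ++ [])) x′ (y′ ++ (z′ ++ []))) (cong ((x ⊕ x′) ++_)
    (trans (zipWith-++ _xor_ y (z ++ []) y′ (z′ ++ [])) (cong ((y ⊕ y′) ++_)
      (zipWith-++ _xor_ z [] z′ []))))

join-𝟘 : ∀ m → join {m} 𝟘 𝟘 𝟘 ≡ 𝟘
join-𝟘 m = trans (cong (𝟘 {m} ++_) (trans (cong (𝟘 {m} ++_) (𝟘-++ m)) (𝟘-++ m))) (𝟘-++ m)

module Blocks {m} (A : Sub (3 * m)) (sA : IsSubspace A) where
  open IsSubspace sA

  axis₁ axis₂ axis₃ : Sub m
  axis₁ x = A (join x 𝟘 𝟘)
  axis₂ x = A (join 𝟘 x 𝟘)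
  axis₃ x = A (join 𝟘 𝟘 x)

  axis₁-isSubspace : IsSubspace axis₁
  axis₁-isSubspace = preimage-isSubspace (λ x → join x 𝟘 𝟘) (join-𝟘 m)
    (λ x y → trans (join-⊕ x 𝟘 𝟘 y 𝟘 𝟘)
      (cong₂ (join (x ⊕ y)) (⊕-identityˡ 𝟘) (⊕-identityˡ 𝟘))) sA

  axis₂-isSubspace : IsSubspace axis₂
  axis₂-isSubspace = preimage-isSubspace (λ x → join 𝟘 x 𝟘) (join-𝟘 m)
    (λ x y → trans (join-⊕ 𝟘 x 𝟘 𝟘 y 𝟘)
      (cong₂ (λ u → join u (x ⊕ y)) (⊕-identityˡ 𝟘) (⊕-identityˡ 𝟘))) sA

  axis₃-isSubspace : IsSubspace axis₃
  axis₃-isSubspace = preimage-isSubspace (λ x → join 𝟘 𝟘 x) (join-𝟘 m)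
    (λ x y → trans (join-⊕ 𝟘 𝟘 x 𝟘 𝟘 y)
      (cong₂ (λ u v → join u v (x ⊕ y)) (⊕-identityˡ 𝟘) (⊕-identityˡ 𝟘))) sA

  -- Two points of `A` that agree in two blocks differ by an axis vector, so each fibre lies in a
  -- coset of the axis.
  slice₁ : ∀ y z x u → join x y z ∈ A → join u y z ∈ A → x ⊕ u ∈ axis₁
  slice₁ y z x u p q = subst (_∈ A)
    (trans (join-⊕ x y z u y z) (cong₂ (join (x ⊕ u)) (⊕-self y) (⊕-self z)))
    (⊕-closed _ _ p q)

  slice₂ : ∀ x z y u → join x y z ∈ A → join x u z ∈ A → y ⊕ u ∈ axis₂
  slice₂ x z y u p q = subst (_∈ A)
    (trans (join-⊕ x y z x u z) (cong₂ (λ s → join s (y ⊕ u)) (⊕-self x) (⊕-self z)))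
    (⊕-closed _ _ p q)

  slice₃ : ∀ x y z u → join x y z ∈ A → join x y u ∈ A → z ⊕ u ∈ axis₃
  slice₃ x y z u p q = subst (_∈ A)
    (trans (join-⊕ x y z x y u) (cong₂ (λ s t → join s t (z ⊕ u)) (⊕-self x) (⊕-self y)))
    (⊕-closed _ _ p q)

  axesDim : ℕ
  axesDim = dim axis₁ + (dim axis₂ + dim axis₃)

  -- The reverse implication follows from closure under `⊕`, so this says that `A` is the sum of its
  -- axes.
  IsDirectSum : Set
  IsDirectSum = ∀ x y z → join x y z ∈ A → x ∈ axis₁ × y ∈ axis₂ × z ∈ axis₃

  private
    -- `K` and `L` are the kernels of the projections to the first block and to the first two
    -- blocks; `π₁`, `π₂`, `π₃` are the images of `A`, `K`, `L` in their leading blocks.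
    -- Rank-nullity twice gives `dim-A`, and each axis lies in the matching image.
    K : Sub (m + (m + 0))
    K t = A (𝟘 {m} ++ t)

    L : Sub (m + 0)
    L t = K (𝟘 {m} ++ t)

    π₁ π₂ π₃ : Sub m
    π₁ s = nonempty (λ t → A (s ++ t))
    π₂ s = nonempty (λ t → K (s ++ t))
    π₃ s = nonempty (λ t → L (s ++ t))

    sK : IsSubspace K
    sK = preimage-isSubspace (𝟘 {m} ++_) (𝟘-++ m)
      (λ x y → trans (zipWith-++ _xor_ (𝟘 {m}) x 𝟘 y) (cong (_++ (x ⊕ y)) (⊕-identityˡ 𝟘))) sA

    axis₁⊆π₁ : axis₁ ⊆ π₁
    axis₁⊆π₁ x = nonempty-intro (λ t → A (x ++ t)) (𝟘 {m} ++ (𝟘 {m} ++ []))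

    axis₂⊆π₂ : axis₂ ⊆ π₂
    axis₂⊆π₂ x = nonempty-intro (λ t → K (x ++ t)) (𝟘 {m} ++ [])

    axis₃⊆π₃ : axis₃ ⊆ π₃
    axis₃⊆π₃ x = nonempty-intro (λ t → L (x ++ t)) []

    d₁≤ : dim axis₁ ≤ dim π₁
    d₁≤ = dim-mono axis₁ π₁ axis₁⊆π₁

    d₂≤ : dim axis₂ ≤ dim π₂
    d₂≤ = dim-mono axis₂ π₂ axis₂⊆π₂

    d₃≤ : dim axis₃ ≤ dim L
    -- `L` lives on `m + 0` coordinates; `π₃` drops the empty last block, whose `dim` reduces to 0.
    d₃≤ = ≤-trans (dim-mono axis₃ π₃ axis₃⊆π₃)
      (≤-trans (m≤m+n (dim π₃) 0) (≤-reflexive (sym (dim-++ m L))))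

    dim-A : dim A ≡ dim π₁ + (dim π₂ + dim L)
    dim-A = trans (dim-++ m A) (cong (λ t → dim π₁ + t) (dim-++ m K))

    -- Peel off blocks: `π₁` equals `axis₁`, so (x,0,0) can be subtracted, leaving (0,y,z) in `A`;
    -- then `y` is removed in the same way, and the remainder (0,0,z) is on the third axis.
    directSum : dim π₁ ≤ dim axis₁ → dim π₂ ≤ dim axis₂ → IsDirectSum
    directSum e₁ e₂ x y z p = x∈ , y∈ , z∈
      where
      x∈ : x ∈ axis₁
      x∈ = ⊆-dim-≤⇒⊇ axis₁-isSubspace (projection-isSubspace m sA) axis₁⊆π₁ e₁ x
        (nonempty-intro (λ t → A (x ++ t)) (y ++ (z ++ [])) p)
      yz∈ : join 𝟘 y z ∈ A
      yz∈ = subst (_∈ A) (trans (join-⊕ x y z x 𝟘 𝟘)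
          (trans (cong (λ u → join u (y ⊕ 𝟘) (z ⊕ 𝟘)) (⊕-self x))
                 (cong₂ (join 𝟘) (⊕-identityʳ y) (⊕-identityʳ z))))
        (⊕-closed _ _ p x∈)
      y∈ : y ∈ axis₂
      y∈ = ⊆-dim-≤⇒⊇ axis₂-isSubspace (projection-isSubspace m sK) axis₂⊆π₂ e₂ y
        (nonempty-intro (λ t → K (y ++ t)) (z ++ []) yz∈)
      z∈ : join 𝟘 𝟘 z ∈ A
      z∈ = subst (_∈ A) (trans (join-⊕ 𝟘 y z 𝟘 y 𝟘)
          (trans (cong₂ (λ u v → join u v (z ⊕ 𝟘)) (⊕-identityˡ 𝟘) (⊕-self y))
                 (cong (join 𝟘 𝟘) (⊕-identityʳ z))))
        (⊕-closed _ _ yz∈ y∈)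

  -- Compare termwise with `dim-A`: strictness in one of the first two terms makes the total strict,
  -- and equality in both gives `directSum`.
  axesDim-dichotomy : axesDim < dim A ⊎ (axesDim ≤ dim A × IsDirectSum)
  axesDim-dichotomy rewrite dim-A with m≤n⇒m<n∨m≡n d₁≤ | m≤n⇒m<n∨m≡n d₂≤
  ... | inj₁ lt | _       = inj₁ (+-mono-<-≤ lt (+-mono-≤ d₂≤ d₃≤))
  ... | inj₂ _  | inj₁ lt = inj₁ (+-mono-≤-< d₁≤ (+-mono-<-≤ lt d₃≤))
  ... | inj₂ e₁ | inj₂ e₂ = inj₂
    ( +-mono-≤ d₁≤ (+-mono-≤ d₂≤ d₃≤)
    , directSum (≤-reflexive (sym e₁)) (≤-reflexive (sym e₂)))

-- Sums over the cube

-- The semiring is a parameter because coefficients live in ℤ and masses in ℕ.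
module CubeSum {c ℓ} (R : CommutativeSemiring c ℓ) where
  private module R = CommutativeSemiring R
  open R using (Carrier; _≈_) renaming (_+_ to _⊞_; _*_ to _⊠_)
  open CommutativeSemigroupProperties R.+-commutativeSemigroup using (interchange)

  sum : ∀ {n} → (F2^ n → Carrier) → Carrier
  sum {zero}  f = f []
  sum {suc n} f = sum (f ∘ (false ∷_)) ⊞ sum (f ∘ (true ∷_))

  sum-cong : ∀ {n} {f g : F2^ n → Carrier} → (∀ x → f x ≈ g x) → sum f ≈ sum g
  sum-cong {zero}  h = h []
  sum-cong {suc n} h = R.+-cong (sum-cong (h ∘ (false ∷_))) (sum-cong (h ∘ (true ∷_)))

  sum-+ : ∀ {n} (f g : F2^ n → Carrier) → sum (λ x → f x ⊞ g x) ≈ sum f ⊞ sum g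
  sum-+ {zero}  f g = R.refl
  sum-+ {suc n} f g = R.trans
    (R.+-cong (sum-+ (f ∘ (false ∷_)) (g ∘ (false ∷_))) (sum-+ (f ∘ (true ∷_)) (g ∘ (true ∷_))))
    (interchange _ _ _ _)

  sum-*ˡ : ∀ {n} a (f : F2^ n → Carrier) → sum (λ x → a ⊠ f x) ≈ a ⊠ sum f
  sum-*ˡ {zero}  a f = R.refl
  sum-*ˡ {suc n} a f = R.trans
    (R.+-cong (sum-*ˡ a (f ∘ (false ∷_))) (sum-*ˡ a (f ∘ (true ∷_))))
    (R.sym (R.distribˡ _ _ _))

  sum-*ʳ : ∀ {n} a (f : F2^ n → Carrier) → sum (λ x → f x ⊠ a) ≈ sum f ⊠ a
  sum-*ʳ {zero}  a f = R.refl
  sum-*ʳ {suc n} a f = R.trans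
    (R.+-cong (sum-*ʳ a (f ∘ (false ∷_))) (sum-*ʳ a (f ∘ (true ∷_))))
    (R.sym (R.distribʳ _ _ _))

  sum-++ : ∀ a {b} (f : F2^ (a + b) → Carrier) → sum f ≈ sum {a} (λ x → sum (λ y → f (x ++ y)))
  sum-++ zero    f = R.refl
  sum-++ (suc a) f = R.+-cong (sum-++ a (f ∘ (false ∷_))) (sum-++ a (f ∘ (true ∷_)))

  sum-swap : ∀ {a b} (f : F2^ a → F2^ b → Carrier) →
    sum (λ x → sum (f x)) ≈ sum (λ y → sum (λ x → f x y))
  sum-swap {zero}  f = R.refl
  sum-swap {suc a} {b} f = R.trans
    (R.+-cong (sum-swap (f ∘ (false ∷_))) (sum-swap (f ∘ (true ∷_))))
    (R.sym (sum-+ {b} _ _))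

  sum₃ : ∀ {m} → (F2^ m → F2^ m → F2^ m → Carrier) → Carrier
  sum₃ f = sum (λ x → sum (λ y → sum (f x y)))

  sum-join : ∀ m (f : F2^ (3 * m) → Carrier) → sum f ≈ sum₃ {m} (λ x y z → f (join x y z))
  sum-join m f = R.trans (sum-++ m f) (sum-cong {m} λ x →
    R.trans (sum-++ m (λ t → f (x ++ t))) (sum-cong {m} λ y →
      sum-++ m (λ t → f (x ++ (y ++ t)))))

  sum₃-cong : ∀ {m} {f g : F2^ m → F2^ m → F2^ m → Carrier} →
    (∀ x y z → f x y z ≈ g x y z) → sum₃ f ≈ sum₃ g
  sum₃-cong h = sum-cong λ x → sum-cong λ y → sum-cong (h x y)

  sum₃-+ : ∀ {m} (f g : F2^ m → F2^ m → F2^ m → Carrier) →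
    sum₃ (λ x y z → f x y z ⊞ g x y z) ≈ sum₃ f ⊞ sum₃ g
  sum₃-+ {m} f g = R.trans
    (sum-cong λ x → R.trans (sum-cong λ y → sum-+ (f x y) (g x y)) (sum-+ {m} _ _))
    (sum-+ {m} _ _)

  sum₃-*ˡ : ∀ {m} a (f : F2^ m → F2^ m → F2^ m → Carrier) →
    sum₃ (λ x y z → a ⊠ f x y z) ≈ a ⊠ sum₃ f
  sum₃-*ˡ {m} a f = R.trans
    (sum-cong λ x → R.trans (sum-cong λ y → sum-*ˡ a (f x y)) (sum-*ˡ {m} a _))
    (sum-*ˡ {m} a _)

  sum₃-product : ∀ {m} (f g h : F2^ m → Carrier) →
    sum₃ (λ x y z → f x ⊠ (g y ⊠ h z)) ≈ sum f ⊠ (sum g ⊠ sum h)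
  sum₃-product {m} f g h = R.trans
    (sum-cong λ x → R.trans
      (sum-cong λ y → R.trans (sum-*ˡ {m} (f x) _) (R.*-congˡ (sum-*ˡ (g y) h)))
      (R.trans (sum-*ˡ {m} (f x) _) (R.*-congˡ (sum-*ʳ (sum h) g))))
    (sum-*ʳ _ f)

module Σℕ = CubeSum +-*-commutativeSemiring
module Σℤ = CubeSum ℤ.+-*-commutativeSemiring

-- Fourier coefficients of iterated majorities

sign-xor : ∀ a b → sign (a xor b) ≡ sign a ℤ.* sign b
sign-xor false false = refl
sign-xor false true  = refl
sign-xor true  false = refl
sign-xor true  true  = refl

dot-++ : ∀ {a b} (s x : F2^ a) (t y : F2^ b) → dot (s ++ t) (x ++ y) ≡ dot s x xor dot t y
dot-++ []      []      t y = refl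
dot-++ (b ∷ s) (c ∷ x) t y =
  trans (cong ((b ∧ c) xor_) (dot-++ s x t y)) (sym (xor-assoc (b ∧ c) (dot s x) (dot t y)))

χ-++ : ∀ {a b} (s x : F2^ a) (t y : F2^ b) → χ (s ++ t) (x ++ y) ≡ χ s x ℤ.* χ t y
χ-++ s x t y = trans (cong sign (dot-++ s x t y)) (sign-xor (dot s x) (dot t y))

χ-join : ∀ {m} (a b c x y z : F2^ m) →
  χ (join a b c) (join x y z) ≡ χ a x ℤ.* (χ b y ℤ.* χ c z)
χ-join a b c x y z = trans (χ-++ a x _ _) (cong (χ a x ℤ.*_)
  (trans (χ-++ b y _ _) (cong (χ b y ℤ.*_)
    (trans (χ-++ c z [] []) (ℤ.*-identityʳ (χ c z))))))

splitAt-++ : ∀ {A : Set} m {n} (x : Vec A m) (y : Vec A n) → splitAt m (x ++ y) ≡ (x , y , refl)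
splitAt-++ zero    []      y = refl
splitAt-++ (suc m) (b ∷ x) y rewrite splitAt-++ m x y = refl

majIter-join : ∀ k (x y z : F2^ (3 ^ k)) →
  majIter (suc k) (join x y z) ≡ maj3 (majIter k x) (majIter k y) (majIter k z)
majIter-join k x y z
  rewrite splitAt-++ (3 ^ k) x (y ++ (z ++ []))
        | splitAt-++ (3 ^ k) y (z ++ [])
        | splitAt-++ (3 ^ k) z [] = refl

-- The Fourier expansion of Maj₃, with the cubic term moved to the left.
sign-maj3 : ∀ a b c →
  + 2 ℤ.* sign (maj3 a b c) ℤ.+ sign a ℤ.* (sign b ℤ.* sign c) ≡ sign a ℤ.+ (sign b ℤ.+ sign c)
sign-maj3 false false false = refl
sign-maj3 false false true  = refl
sign-maj3 false true  false = refl
sign-maj3 false true  true  = refl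
sign-maj3 true  false false = refl
sign-maj3 true  false true  = refl
sign-maj3 true  true  false = refl
sign-maj3 true  true  true  = refl

-- 2ⁿ times the Fourier coefficient.
coeff : ∀ {n} → (F2^ n → ℤ) → F2^ n → ℤ
coeff f S = Σℤ.sum (λ x → f x ℤ.* χ S x)

-- The unnormalised Fourier coefficient of the constant 1: 2ⁿ at `𝟘` and 0 elsewhere. It enters
-- `coeff-join` for each block absent from a linear term of Maj₃.
Δ : ∀ {n} → F2^ n → ℤ
Δ S = Σℤ.sum (χ S)

δ : ∀ {n} → F2^ n → ℕ
δ []          = 1
δ (false ∷ S) = δ S
δ (true ∷ S)  = 0

δ-cases : ∀ {n} (S : F2^ n) → δ S ≡ 0 ⊎ S ≡ 𝟘
δ-cases []          = inj₂ refl
δ-cases (true ∷ S)  = inj₁ refl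
δ-cases (false ∷ S) with δ-cases S
... | inj₁ p = inj₁ p
... | inj₂ p = inj₂ (cong (false ∷_) p)

δ-idem : ∀ {n} (S : F2^ n) → δ S * δ S ≡ δ S
δ-idem []          = refl
δ-idem (true ∷ S)  = refl
δ-idem (false ∷ S) = δ-idem S

Δ-δ : ∀ {n} (S : F2^ n) → Δ S ≡ + (δ S * 2 ^ n)
Δ-δ []                  = refl
Δ-δ {suc n} (false ∷ S) = trans (cong₂ ℤ._+_ (Δ-δ S) (Δ-δ S)) (cong +_ (double (δ S) (2 ^ n)))
  where
  double : ∀ a b → a * b + a * b ≡ a * (2 * b)
  double = ℕ-Ring.solve-∀
-- A leading `true` flips the sign on the half-cube with first bit 1, so the two halves cancel.
Δ-δ (true ∷ S) = trans
  (cong (λ t → Δ S ℤ.+ t) (trans (Σℤ.sum-cong (λ x → sign-xor true (dot S x))) (Σℤ.sum-*ˡ (- (+ 1)) (χ S))))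
  (cancel (Δ S))
  where
  cancel : ∀ i → i ℤ.+ - (+ 1) ℤ.* i ≡ + 0
  cancel = ℤ-Ring.solve-∀

-- Multiply the expansion `sign-maj3` by the character of the three blocks and sum; every term on
-- blocks is a product, so its sum factors. Doubling avoids the ½.
coeff-join : ∀ k (a b c : F2^ (3 ^ k)) →
  let F = coeff (MajK k) in
  + 2 ℤ.* coeff (MajK (suc k)) (join a b c) ℤ.+ F a ℤ.* (F b ℤ.* F c) ≡
  F a ℤ.* (Δ b ℤ.* Δ c) ℤ.+ (Δ a ℤ.* (F b ℤ.* Δ c) ℤ.+ Δ a ℤ.* (Δ b ℤ.* F c))
coeff-join k a b c = begin
  + 2 ℤ.* coeff (MajK (suc k)) (join a b c) ℤ.+ F a ℤ.* (F b ℤ.* F c)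
    ≡⟨ cong₂ ℤ._+_
         (trans (cong (+ 2 ℤ.*_) (Σℤ.sum-join (3 ^ k) _)) (sym (Σℤ.sum₃-*ˡ (+ 2) whole)))
         (sym (Σℤ.sum₃-product (f a) (f b) (f c))) ⟩
  Σℤ.sum₃ (λ x y z → + 2 ℤ.* whole x y z) ℤ.+
    Σℤ.sum₃ (λ x y z → f a x ℤ.* (f b y ℤ.* f c z))
    ≡⟨ sym (Σℤ.sum₃-+ {3 ^ k} _ _) ⟩
  Σℤ.sum₃ (λ x y z → + 2 ℤ.* whole x y z ℤ.+ f a x ℤ.* (f b y ℤ.* f c z))
    ≡⟨ Σℤ.sum₃-cong pointwise ⟩
  Σℤ.sum₃ (λ x y z → f a x ℤ.* (χ b y ℤ.* χ c z) ℤ.+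
    (χ a x ℤ.* (f b y ℤ.* χ c z) ℤ.+ χ a x ℤ.* (χ b y ℤ.* f c z)))
    ≡⟨ trans (Σℤ.sum₃-+ {3 ^ k} _ _) (cong₂ ℤ._+_ (Σℤ.sum₃-product (f a) (χ b) (χ c))
         (trans (Σℤ.sum₃-+ {3 ^ k} _ _) (cong₂ ℤ._+_ (Σℤ.sum₃-product (χ a) (f b) (χ c))
           (Σℤ.sum₃-product (χ a) (χ b) (f c))))) ⟩
  F a ℤ.* (Δ b ℤ.* Δ c) ℤ.+ (Δ a ℤ.* (F b ℤ.* Δ c) ℤ.+ Δ a ℤ.* (Δ b ℤ.* F c)) ∎
  where
  open ≡-Reasoning
  F = coeff (MajK k)

  f : F2^ (3 ^ k) → F2^ (3 ^ k) → ℤ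
  f s x = MajK k x ℤ.* χ s x

  whole : F2^ (3 ^ k) → F2^ (3 ^ k) → F2^ (3 ^ k) → ℤ
  whole x y z = MajK (suc k) (join x y z) ℤ.* χ (join a b c) (join x y z)

  expand : ∀ t p q r X Y Z →
    + 2 ℤ.* (t ℤ.* (X ℤ.* (Y ℤ.* Z))) ℤ.+ (p ℤ.* X) ℤ.* ((q ℤ.* Y) ℤ.* (r ℤ.* Z)) ≡
    (+ 2 ℤ.* t ℤ.+ p ℤ.* (q ℤ.* r)) ℤ.* (X ℤ.* (Y ℤ.* Z))
  expand = ℤ-Ring.solve-∀

  distribute : ∀ p q r X Y Z → (p ℤ.+ (q ℤ.+ r)) ℤ.* (X ℤ.* (Y ℤ.* Z)) ≡
    (p ℤ.* X) ℤ.* (Y ℤ.* Z) ℤ.+ (X ℤ.* ((q ℤ.* Y) ℤ.* Z) ℤ.+ X ℤ.* (Y ℤ.* (r ℤ.* Z)))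
  distribute = ℤ-Ring.solve-∀

  pointwise : ∀ x y z → + 2 ℤ.* whole x y z ℤ.+ f a x ℤ.* (f b y ℤ.* f c z) ≡
    f a x ℤ.* (χ b y ℤ.* χ c z) ℤ.+ (χ a x ℤ.* (f b y ℤ.* χ c z) ℤ.+ χ a x ℤ.* (χ b y ℤ.* f c z))
  pointwise x y z = trans
    (cong (λ t → + 2 ℤ.* t ℤ.+ f a x ℤ.* (f b y ℤ.* f c z))
      (cong₂ ℤ._*_ (cong sign (majIter-join k x y z)) (χ-join a b c x y z)))
    (trans (expand (sign (maj3 p q r)) (sign p) (sign q) (sign r) (χ a x) (χ b y) (χ c z))
      (trans (cong (ℤ._* (χ a x ℤ.* (χ b y ℤ.* χ c z))) (sign-maj3 p q r))
        (distribute (sign p) (sign q) (sign r) (χ a x) (χ b y) (χ c z))))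
    where
    p = majIter k x
    q = majIter k y
    r = majIter k z

-- At `𝟘` every term of `coeff-join` but the first contains the factor `coeff (MajK k) 𝟘`, which
-- vanishes by induction.
coeff-𝟘 : ∀ k → coeff (MajK k) 𝟘 ≡ + 0
coeff-𝟘 zero    = refl
coeff-𝟘 (suc k) = trans (cong (coeff (MajK (suc k))) (sym (join-𝟘 (3 ^ k))))
  (cancel (coeff (MajK (suc k)) (join {3 ^ k} 𝟘 𝟘 𝟘)) (coeff (MajK k) 𝟘) (Δ {3 ^ k} 𝟘)
    (coeff-𝟘 k) (coeff-join k 𝟘 𝟘 𝟘))
  where
  cancel : ∀ t F D → F ≡ + 0 → + 2 ℤ.* t ℤ.+ F ℤ.* (F ℤ.* F) ≡
    F ℤ.* (D ℤ.* D) ℤ.+ (D ℤ.* (F ℤ.* D) ℤ.+ D ℤ.* (D ℤ.* F)) → t ≡ + 0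
  cancel t _ D refl e =
    [ (λ ()) , id ]′ (ℤ.i*j≡0⇒i≡0∨j≡0 (+ 2) (trans (lhs t) (trans e (rhs D))))
    where
    lhs : ∀ t → + 2 ℤ.* t ≡ + 2 ℤ.* t ℤ.+ + 0
    lhs = ℤ-Ring.solve-∀
    rhs : ∀ D → + 0 ℤ.+ (D ℤ.* (+ 0 ℤ.* D) ℤ.+ D ℤ.* (D ℤ.* + 0)) ≡ + 0
    rhs = ℤ-Ring.solve-∀

-- Disjoint supports: the coefficient vanishes at `𝟘`, and `Δ` everywhere else.
coeff*Δ : ∀ k (S : F2^ (3 ^ k)) → coeff (MajK k) S ℤ.* Δ S ≡ + 0
coeff*Δ k S with δ-cases S
... | inj₂ refl = cong (ℤ._* Δ S) (coeff-𝟘 k)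
... | inj₁ p    = trans
  (cong (coeff (MajK k) S ℤ.*_) (trans (Δ-δ S) (cong (λ d → + (d * 2 ^ (3 ^ k))) p)))
  (ℤ.*-zeroʳ (coeff (MajK k) S))

-- Any two of the four terms of the expansion have product zero, so the square of their sum is the
-- sum of their squares. The 4 is the square of the 2 in front of `t`.
square-of-sum : ∀ t x₁ x₂ x₃ z₁ z₂ z₃ →
  + 2 ℤ.* t ℤ.+ x₁ ℤ.* (x₂ ℤ.* x₃) ≡
    x₁ ℤ.* (z₂ ℤ.* z₃) ℤ.+ (z₁ ℤ.* (x₂ ℤ.* z₃) ℤ.+ z₁ ℤ.* (z₂ ℤ.* x₃)) →
  x₁ ℤ.* z₁ ≡ + 0 → x₂ ℤ.* z₂ ≡ + 0 →
  let sq = λ i → i ℤ.* i in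
  + 4 ℤ.* sq t ≡
    (sq x₁ ℤ.* (sq z₂ ℤ.* sq z₃) ℤ.+ (sq z₁ ℤ.* (sq x₂ ℤ.* sq z₃) ℤ.+ sq z₁ ℤ.* (sq z₂ ℤ.* sq x₃)))
      ℤ.+ sq x₁ ℤ.* (sq x₂ ℤ.* sq x₃)
square-of-sum t x₁ x₂ x₃ z₁ z₂ z₃ e o₁ o₂ = begin
  + 4 ℤ.* (t ℤ.* t)
    ≡⟨ complete t (x₁ ℤ.* (x₂ ℤ.* x₃)) ⟩
  sq ((+ 2 ℤ.* t ℤ.+ x₁ ℤ.* (x₂ ℤ.* x₃)) ℤ.- x₁ ℤ.* (x₂ ℤ.* x₃))
    ≡⟨ cong (λ s → sq (s ℤ.- x₁ ℤ.* (x₂ ℤ.* x₃))) e ⟩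
  sq ((x₁ ℤ.* (z₂ ℤ.* z₃) ℤ.+ (z₁ ℤ.* (x₂ ℤ.* z₃) ℤ.+ z₁ ℤ.* (z₂ ℤ.* x₃)))
       ℤ.- x₁ ℤ.* (x₂ ℤ.* x₃))
    ≡⟨ expand x₁ x₂ x₃ z₁ z₂ z₃ ⟩
  diagonal ℤ.+ cross (x₁ ℤ.* z₁) (x₂ ℤ.* z₂)
    ≡⟨ cong (λ s → diagonal ℤ.+ s) (cong₂ cross o₁ o₂) ⟩
  diagonal ℤ.+ cross (+ 0) (+ 0)
    ≡⟨ ℤ.+-identityʳ diagonal ⟩
  diagonal ∎
  where
  open ≡-Reasoning
  sq : ℤ → ℤ
  sq i = i ℤ.* i

  diagonal : ℤ
  diagonal =
    (sq x₁ ℤ.* (sq z₂ ℤ.* sq z₃) ℤ.+ (sq z₁ ℤ.* (sq x₂ ℤ.* sq z₃) ℤ.+ sq z₁ ℤ.* (sq z₂ ℤ.* sq x₃)))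
      ℤ.+ sq x₁ ℤ.* (sq x₂ ℤ.* sq x₃)

  -- Every product of two different terms contains `x₁ ℤ.* z₁` or `x₂ ℤ.* z₂`; `cross` is twice the
  -- signed sum of these products, sorted by that factor.
  cross : ℤ → ℤ → ℤ
  cross o₁ o₂ =
    o₁ ℤ.* (+ 2 ℤ.* (x₂ ℤ.* z₂ ℤ.* (z₃ ℤ.* z₃) ℤ.+ x₃ ℤ.* z₃ ℤ.* (z₂ ℤ.* z₂)
      ℤ.- x₂ ℤ.* x₂ ℤ.* (x₃ ℤ.* z₃) ℤ.- x₃ ℤ.* x₃ ℤ.* (x₂ ℤ.* z₂)))
    ℤ.+ o₂ ℤ.* (+ 2 ℤ.* (x₃ ℤ.* z₃ ℤ.* (z₁ ℤ.* z₁) ℤ.- x₁ ℤ.* x₁ ℤ.* (x₃ ℤ.* z₃)))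

  complete : ∀ t q → + 4 ℤ.* (t ℤ.* t) ≡
    ((+ 2 ℤ.* t ℤ.+ q) ℤ.- q) ℤ.* ((+ 2 ℤ.* t ℤ.+ q) ℤ.- q)
  complete = ℤ-Ring.solve-∀

  expand : ∀ x₁ x₂ x₃ z₁ z₂ z₃ →
    ((x₁ ℤ.* (z₂ ℤ.* z₃) ℤ.+ (z₁ ℤ.* (x₂ ℤ.* z₃) ℤ.+ z₁ ℤ.* (z₂ ℤ.* x₃)))
       ℤ.- x₁ ℤ.* (x₂ ℤ.* x₃)) ℤ.*
    ((x₁ ℤ.* (z₂ ℤ.* z₃) ℤ.+ (z₁ ℤ.* (x₂ ℤ.* z₃) ℤ.+ z₁ ℤ.* (z₂ ℤ.* x₃)))
       ℤ.- x₁ ℤ.* (x₂ ℤ.* x₃)) ≡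
    ((x₁ ℤ.* x₁ ℤ.* (z₂ ℤ.* z₂ ℤ.* (z₃ ℤ.* z₃)) ℤ.+
      (z₁ ℤ.* z₁ ℤ.* (x₂ ℤ.* x₂ ℤ.* (z₃ ℤ.* z₃)) ℤ.+ z₁ ℤ.* z₁ ℤ.* (z₂ ℤ.* z₂ ℤ.* (x₃ ℤ.* x₃))))
      ℤ.+ x₁ ℤ.* x₁ ℤ.* (x₂ ℤ.* x₂ ℤ.* (x₃ ℤ.* x₃))) ℤ.+
    ((x₁ ℤ.* z₁) ℤ.* (+ 2 ℤ.* (x₂ ℤ.* z₂ ℤ.* (z₃ ℤ.* z₃) ℤ.+ x₃ ℤ.* z₃ ℤ.* (z₂ ℤ.* z₂)
      ℤ.- x₂ ℤ.* x₂ ℤ.* (x₃ ℤ.* z₃) ℤ.- x₃ ℤ.* x₃ ℤ.* (x₂ ℤ.* z₂)))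
    ℤ.+ (x₂ ℤ.* z₂) ℤ.* (+ 2 ℤ.* (x₃ ℤ.* z₃ ℤ.* (z₁ ℤ.* z₁) ℤ.- x₁ ℤ.* x₁ ℤ.* (x₃ ℤ.* z₃))))
  expand = ℤ-Ring.solve-∀

-- 4ⁿ f̂(S)² with n = 3ᵏ, taken in ℕ so that masses are compared without signs or denominators.
energy : ∀ k → F2^ (3 ^ k) → ℕ
energy k S = ∣ coeff (MajK k) S ℤ.* coeff (MajK k) S ∣

coeff²≡energy : ∀ k S → coeff (MajK k) S ℤ.* coeff (MajK k) S ≡ + energy k S
coeff²≡energy k S = nonNeg (coeff (MajK k) S)
  where
  nonNeg : ∀ i → i ℤ.* i ≡ + ∣ i ℤ.* i ∣
  nonNeg (+ zero)    = refl
  nonNeg (+ suc n)   = refl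
  nonNeg (ℤ.-[1+ n ]) = refl

-- 4ⁿ for n = 3ᵏ: the common denominator of the squared coefficients and, by `parseval`, the total
-- energy.
total : ℕ → ℕ
total k = 2 ^ (3 ^ k) * 2 ^ (3 ^ k)

total-suc : ∀ k → total (suc k) ≡ total k * (total k * total k)
total-suc k = trans (cong (λ t → t * t) power) (rearrange (2 ^ m))
  where
  m = 3 ^ k
  power : 2 ^ (m + (m + (m + 0))) ≡ 2 ^ m * (2 ^ m * (2 ^ m * 1))
  power = trans (^-distribˡ-+-* 2 m (m + (m + 0))) (cong (2 ^ m *_)
    (trans (^-distribˡ-+-* 2 m (m + 0)) (cong (2 ^ m *_) (^-distribˡ-+-* 2 m 0))))
  rearrange : ∀ t → (t * (t * (t * 1))) * (t * (t * (t * 1))) ≡ (t * t) * ((t * t) * (t * t))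
  rearrange = ℕ-Ring.solve-∀

Δ² : ∀ k (S : F2^ (3 ^ k)) → Δ S ℤ.* Δ S ≡ + (δ S * total k)
Δ² k S = begin
  Δ S ℤ.* Δ S                                   ≡⟨ cong₂ ℤ._*_ (Δ-δ S) (Δ-δ S) ⟩
  + (δ S * t) ℤ.* + (δ S * t)                   ≡⟨ sym (ℤ.pos-* (δ S * t) (δ S * t)) ⟩
  + ((δ S * t) * (δ S * t))                     ≡⟨ cong +_ (rearrange (δ S) t) ⟩
  + ((δ S * δ S) * (t * t))                     ≡⟨ cong (λ d → + (d * (t * t))) (δ-idem S) ⟩
  + (δ S * (t * t))                             ∎
  where
  open ≡-Reasoning
  t = 2 ^ (3 ^ k)
  rearrange : ∀ d t → (d * t) * (d * t) ≡ (d * d) * (t * t)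
  rearrange = ℕ-Ring.solve-∀

-- The mixture law for S after scaling: `z` is the point mass at `𝟘` with the same total as `e`, and
-- the 4 clears the probabilities ¼.
energy-join : ∀ k (a b c : F2^ (3 ^ k)) →
  let e = energy k ; z = λ S → δ S * total k in
  4 * energy (suc k) (join a b c) ≡
    (e a * (z b * z c) + (z a * (e b * z c) + z a * (z b * e c))) + e a * (e b * e c)
energy-join k a b c = ℤ.+-injective (begin
  + (4 * energy (suc k) (join a b c))
    ≡⟨ ℤ.pos-* 4 (energy (suc k) (join a b c)) ⟩
  + 4 ℤ.* + energy (suc k) (join a b c)
    ≡⟨ cong (+ 4 ℤ.*_) (sym (coeff²≡energy (suc k) (join a b c))) ⟩
  + 4 ℤ.* (F′ ℤ.* F′)
    ≡⟨ square-of-sum F′ (F a) (F b) (F c) (Δ a) (Δ b) (Δ c)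
         (coeff-join k a b c) (coeff*Δ k a) (coeff*Δ k b) ⟩
  (sq (F a) ℤ.* (sq (Δ b) ℤ.* sq (Δ c)) ℤ.+
    (sq (Δ a) ℤ.* (sq (F b) ℤ.* sq (Δ c)) ℤ.+ sq (Δ a) ℤ.* (sq (Δ b) ℤ.* sq (F c))))
    ℤ.+ sq (F a) ℤ.* (sq (F b) ℤ.* sq (F c))
    ≡⟨ cong₂ ℤ._+_
         (cong₂ ℤ._+_ (triple (e² a) (Δ² k b) (Δ² k c))
           (cong₂ ℤ._+_ (triple (Δ² k a) (e² b) (Δ² k c)) (triple (Δ² k a) (Δ² k b) (e² c))))
         (triple (e² a) (e² b) (e² c)) ⟩
  + ((e a * (z b * z c) + (z a * (e b * z c) + z a * (z b * e c))) + e a * (e b * e c)) ∎)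
  where
  open ≡-Reasoning
  F = coeff (MajK k)
  F′ = coeff (MajK (suc k)) (join a b c)
  e = energy k
  e² = coeff²≡energy k

  z : F2^ (3 ^ k) → ℕ
  z S = δ S * total k

  sq : ℤ → ℤ
  sq i = i ℤ.* i

  triple : ∀ {i j l p q r} → i ≡ + p → j ≡ + q → l ≡ + r →
    i ℤ.* (j ℤ.* l) ≡ + (p * (q * r))
  triple {p = p} {q} {r} refl refl refl =
    trans (cong (+ p ℤ.*_) (sym (ℤ.pos-* q r))) (sym (ℤ.pos-* p (q * r)))

-- Spectral mass of a subset

sum-mono : ∀ {n} {f g : F2^ n → ℕ} → (∀ x → f x ≤ g x) → Σℕ.sum f ≤ Σℕ.sum g
sum-mono {zero}  h = h []
sum-mono {suc n} h = +-mono-≤ (sum-mono (h ∘ (false ∷_))) (sum-mono (h ∘ (true ∷_)))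

sum-δ : ∀ {n} (g : F2^ n → ℕ) → Σℕ.sum (λ S → δ S * g S) ≡ g 𝟘
sum-δ {zero}  g = +-identityʳ (g [])
sum-δ {suc n} g = trans
  (cong₂ _+_ (sum-δ (g ∘ (false ∷_))) (Σℕ.sum-*ˡ {n} 0 (g ∘ (true ∷_))))
  (+-identityʳ _)

module _ {m} (h : F2^ m → F2^ m → F2^ m → ℕ) where

  sum₃-δ₂₃ : Σℕ.sum₃ (λ x y z → δ y * (δ z * h x y z)) ≡ Σℕ.sum (λ x → h x 𝟘 𝟘)
  sum₃-δ₂₃ = Σℕ.sum-cong λ x → trans
    (Σℕ.sum-cong λ y → trans (Σℕ.sum-*ˡ {m} (δ y) _) (cong (δ y *_) (sum-δ (h x y))))
    (sum-δ (λ y → h x y 𝟘))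

  sum₃-δ₁₃ : Σℕ.sum₃ (λ x y z → δ x * (δ z * h x y z)) ≡ Σℕ.sum (λ y → h 𝟘 y 𝟘)
  sum₃-δ₁₃ = trans
    (Σℕ.sum-cong λ x → trans
      (Σℕ.sum-cong λ y → trans (Σℕ.sum-*ˡ {m} (δ x) _) (cong (δ x *_) (sum-δ (h x y))))
      (Σℕ.sum-*ˡ {m} (δ x) _))
    (sum-δ (λ x → Σℕ.sum (λ y → h x y 𝟘)))

  sum₃-δ₁₂ : Σℕ.sum₃ (λ x y z → δ x * (δ y * h x y z)) ≡ Σℕ.sum (h 𝟘 𝟘)
  sum₃-δ₁₂ = trans
    (Σℕ.sum-cong λ x → trans
      (Σℕ.sum-cong {m} λ y → trans (Σℕ.sum-*ˡ {m} (δ x) _)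
        (cong (δ x *_) (Σℕ.sum-*ˡ {m} (δ y) (h x y))))
      (trans (Σℕ.sum-*ˡ {m} (δ x) _) (cong (δ x *_) (sum-δ (λ y → Σℕ.sum (h x y))))))
    (sum-δ (λ x → Σℕ.sum (h x 𝟘)))

-- P(S ∈ A) scaled by `total k`.
mass : ∀ k → Sub (3 ^ k) → ℕ
mass k A = Σℕ.sum (λ S → ⟦ A S ⟧ * energy k S)

mass-mono : ∀ k {A B : Sub (3 ^ k)} → A ⊆ B → mass k A ≤ mass k B
mass-mono k A⊆B = sum-mono λ S → *-monoˡ-≤ (energy k S) (⟦⟧-mono (A⊆B S))

-- The probability that three independent samples satisfy `P`, scaled by the cube of `total k`.
tripleMass : ∀ k → (F2^ (3 ^ k) → F2^ (3 ^ k) → F2^ (3 ^ k) → Bool) → ℕ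
tripleMass k P = Σℕ.sum₃ (λ x y z → ⟦ P x y z ⟧ * (energy k x * (energy k y * energy k z)))

-- Sum `energy-join` over `A`. In the first three cases the point masses restrict the sum to an axis
-- and leave one factor `total k` for each of the two zero blocks.
mass-join : ∀ k (A : Sub (3 ^ suc k)) →
  4 * mass (suc k) A ≡
    total k * total k * (mass k (λ x → A (join x 𝟘 𝟘)) +
      (mass k (λ y → A (join 𝟘 y 𝟘)) + mass k (λ z → A (join 𝟘 𝟘 z))))
    + tripleMass k (λ x y z → A (join x y z))
mass-join k A = begin
  4 * mass (suc k) A
    ≡⟨ cong (4 *_) (Σℕ.sum-join m (λ S → ⟦ A S ⟧ * energy (suc k) S)) ⟩
  4 * Σℕ.sum₃ {m} (λ x y z → a x y z * energy (suc k) (join x y z))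
    ≡⟨ sym (Σℕ.sum₃-*ˡ {m} 4 _) ⟩
  Σℕ.sum₃ {m} (λ x y z → 4 * (a x y z * energy (suc k) (join x y z)))
    ≡⟨ Σℕ.sum₃-cong {m} pointwise ⟩
  Σℕ.sum₃ {m} (λ x y z → (δ y * (δ z * h₁ x y z) + (δ x * (δ z * h₂ x y z) + δ x * (δ y * h₃ x y z)))
    + a x y z * (e x * (e y * e z)))
    ≡⟨ trans (Σℕ.sum₃-+ {m} _ _) (cong (_+ tripleMass k (λ x y z → A (join x y z)))
         (trans (Σℕ.sum₃-+ {m} _ _) (cong₂ _+_ (sum₃-δ₂₃ h₁)
           (trans (Σℕ.sum₃-+ {m} _ _) (cong₂ _+_ (sum₃-δ₁₃ h₂) (sum₃-δ₁₂ h₃)))))) ⟩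
  Σℕ.sum (λ x → h₁ x 𝟘 𝟘) + (Σℕ.sum (λ y → h₂ 𝟘 y 𝟘) + Σℕ.sum (λ z → h₃ 𝟘 𝟘 z)) + T
    ≡⟨ cong (_+ T) (cong₂ _+_ (Σℕ.sum-*ˡ {m} (M * M) _)
         (cong₂ _+_ (Σℕ.sum-*ˡ {m} (M * M) _) (Σℕ.sum-*ˡ {m} (M * M) _))) ⟩
  M * M * p₁ + (M * M * p₂ + M * M * p₃) + T
    ≡⟨ cong (_+ T) (factor (M * M) p₁ p₂ p₃) ⟩
  M * M * (p₁ + (p₂ + p₃)) + T ∎
  where
  open ≡-Reasoning
  m = 3 ^ k
  M = total k
  e = energy k
  T = tripleMass k (λ x y z → A (join x y z))
  p₁ = mass k (λ x → A (join x 𝟘 𝟘))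
  p₂ = mass k (λ y → A (join 𝟘 y 𝟘))
  p₃ = mass k (λ z → A (join 𝟘 𝟘 z))

  a h₁ h₂ h₃ : F2^ m → F2^ m → F2^ m → ℕ
  a x y z = ⟦ A (join x y z) ⟧
  h₁ x y z = M * M * (a x y z * e x)
  h₂ x y z = M * M * (a x y z * e y)
  h₃ x y z = M * M * (a x y z * e z)

  factor : ∀ c p q r → c * p + (c * q + c * r) ≡ c * (p + (q + r))
  factor = ℕ-Ring.solve-∀

  swap4 : ∀ b w → 4 * (b * w) ≡ b * (4 * w)
  swap4 = ℕ-Ring.solve-∀

  expand : ∀ M b x y z dx dy dz →
    b * ((x * (dy * M * (dz * M)) + (dx * M * (y * (dz * M)) + dx * M * (dy * M * z))) + x * (y * z)) ≡
    (dy * (dz * (M * M * (b * x))) + (dx * (dz * (M * M * (b * y))) + dx * (dy * (M * M * (b * z)))))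
      + b * (x * (y * z))
  expand = ℕ-Ring.solve-∀

  pointwise : ∀ x y z → 4 * (a x y z * energy (suc k) (join x y z)) ≡
    (δ y * (δ z * h₁ x y z) + (δ x * (δ z * h₂ x y z) + δ x * (δ y * h₃ x y z)))
      + a x y z * (e x * (e y * e z))
  pointwise x y z = trans (swap4 (a x y z) (energy (suc k) (join x y z)))
    (trans (cong (a x y z *_) (energy-join k x y z))
      (expand M (a x y z) (e x) (e y) (e z) (δ x) (δ y) (δ z)))

-- Induction through `mass-join` for the whole space: the axes contribute 3M³ and the triples M³.
parseval : ∀ k → Σℕ.sum (energy k) ≡ total k
parseval zero    = refl
parseval (suc k) = *-cancelˡ-≡ _ _ 4 (begin
  4 * Σℕ.sum (energy (suc k))
    ≡⟨ cong (4 *_) (sym (full (suc k))) ⟩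
  4 * mass (suc k) (λ _ → true)
    ≡⟨ mass-join k (λ _ → true) ⟩
  M * M * (P + (P + P)) + tripleMass k (λ _ _ _ → true)
    ≡⟨ cong₂ (λ p t → M * M * (p + (p + p)) + t) (trans (full k) (parseval k)) triple ⟩
  M * M * (M + (M + M)) + M * (M * M)
    ≡⟨ collect M ⟩
  4 * (M * (M * M))
    ≡⟨ cong (4 *_) (sym (total-suc k)) ⟩
  4 * total (suc k) ∎)
  where
  open ≡-Reasoning
  M = total k
  P = mass k (λ _ → true)

  full : ∀ k → mass k (λ _ → true) ≡ Σℕ.sum (energy k)
  full k = Σℕ.sum-cong {3 ^ k} λ S → *-identityˡ (energy k S)

  triple : tripleMass k (λ _ _ _ → true) ≡ M * (M * M)
  triple = trans (Σℕ.sum₃-cong {3 ^ k} λ x y z → *-identityˡ (energy k x * (energy k y * energy k z)))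
    (trans (Σℕ.sum₃-product (energy k) (energy k) (energy k))
      (cong₂ _*_ (parseval k) (cong₂ _*_ (parseval k) (parseval k))))

  collect : ∀ M → M * M * (M + (M + M)) + M * (M * M) ≡ 4 * (M * (M * M))
  collect = ℕ-Ring.solve-∀

-- The hypothesis bounds the third block for each choice of the first two; summing over those gives
-- `total k` twice, by `parseval`.
tripleMass-bound : ∀ k (P : F2^ (3 ^ k) → F2^ (3 ^ k) → F2^ (3 ^ k) → Bool) r c →
  (∀ x y → r * mass k (P x y) ≤ c) → r * tripleMass k P ≤ total k * total k * c
tripleMass-bound k P r c h = begin
  r * tripleMass k P
    ≡⟨ sym (Σℕ.sum₃-*ˡ {m} r _) ⟩
  Σℕ.sum₃ {m} (λ x y z → r * (⟦ P x y z ⟧ * (e x * (e y * e z))))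
    ≡⟨ Σℕ.sum-cong {m} (λ x → Σℕ.sum-cong {m} (λ y → inner x y)) ⟩
  Σℕ.sum {m} (λ x → Σℕ.sum {m} (λ y → e x * e y * (r * mass k (P x y))))
    ≤⟨ sum-mono {m} (λ x → sum-mono {m} (λ y → *-monoʳ-≤ (e x * e y) (h x y))) ⟩
  Σℕ.sum {m} (λ x → Σℕ.sum {m} (λ y → e x * e y * c))
    ≡⟨ Σℕ.sum-cong {m} (λ x → trans (Σℕ.sum-*ʳ {m} c _)
         (cong (_* c) (trans (Σℕ.sum-*ˡ {m} (e x) e) (cong (e x *_) (parseval k))))) ⟩
  Σℕ.sum {m} (λ x → e x * total k * c)
    ≡⟨ trans (Σℕ.sum-*ʳ {m} c _) (cong (_* c) (trans (Σℕ.sum-*ʳ {m} (total k) e)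
         (cong (_* total k) (parseval k)))) ⟩
  total k * total k * c ∎
  where
  open ≤-Reasoning
  m = 3 ^ k
  e = energy k

  rearrange : ∀ r b x y z → r * (b * (x * (y * z))) ≡ x * y * r * (b * z)
  rearrange = ℕ-Ring.solve-∀

  inner : ∀ x y → Σℕ.sum {m} (λ z → r * (⟦ P x y z ⟧ * (e x * (e y * e z)))) ≡
    e x * e y * (r * mass k (P x y))
  inner x y = trans (Σℕ.sum-cong {m} λ z → rearrange r ⟦ P x y z ⟧ (e x) (e y) (e z))
    (trans (Σℕ.sum-*ˡ {m} (e x * e y * r) _) (*-assoc (e x * e y) r (mass k (P x y))))

-- The weight is symmetric in the blocks, so transpositions move any block to the last place, where
-- `tripleMass-bound` applies.
tripleMass-swap₂₃ : ∀ k P → tripleMass k P ≡ tripleMass k (λ x z y → P x y z)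
tripleMass-swap₂₃ k P = Σℕ.sum-cong {m} λ x → trans (Σℕ.sum-swap {m} {m} _)
  (Σℕ.sum-cong {m} λ z → Σℕ.sum-cong {m} λ y →
    cong (λ t → ⟦ P x y z ⟧ * (energy k x * t)) (*-comm (energy k y) (energy k z)))
  where m = 3 ^ k

tripleMass-swap₁₂ : ∀ k P → tripleMass k P ≡ tripleMass k (λ y x z → P x y z)
tripleMass-swap₁₂ k P = trans (Σℕ.sum-swap {m} {m} _)
  (Σℕ.sum-cong {m} λ y → Σℕ.sum-cong {m} λ x → Σℕ.sum-cong {m} λ z →
    cong (⟦ P x y z ⟧ *_) (rearrange (energy k x) (energy k y) (energy k z)))
  where
  m = 3 ^ k
  rearrange : ∀ x y z → x * (y * z) ≡ y * (x * z)
  rearrange = ℕ-Ring.solve-∀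

-- The induction

-- P(S ∈ A) ≤ dim A / 3ᵏ with denominators cleared. Quantifying over all subspaces lets the
-- induction use it for the axes and for their extensions by a vector.
MassBound : ℕ → Set
MassBound k = ∀ A → IsSubspace A → 3 ^ k * mass k A ≤ dim A * total k

-- A coset of a d-dimensional subspace lies in a (d+1)-dimensional one.
coset-bound : ∀ k → MassBound k → ∀ {A} → IsSubspace A → (Q : Sub (3 ^ k)) →
  (∀ x u → x ∈ Q → u ∈ Q → x ⊕ u ∈ A) → 3 ^ k * mass k Q ≤ suc (dim A) * total k
coset-bound k ih {A} sA Q h with nonempty Q in eq
... | true with nonempty-elim Q eq
...   | u , u∈ = begin
  3 ^ k * mass k Q              ≤⟨ *-monoʳ-≤ (3 ^ k) (mass-mono k Q⊆) ⟩
  3 ^ k * mass k (extend u A)   ≤⟨ ih (extend u A) (extend-isSubspace u sA) ⟩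
  dim (extend u A) * total k    ≤⟨ *-monoˡ-≤ (total k) (dim-extend u sA) ⟩
  suc (dim A) * total k         ∎
  where
  open ≤-Reasoning
  Q⊆ : Q ⊆ extend u A
  Q⊆ x p = ∨-introʳ (A x) (h x u p u∈)
-- An empty `Q` offers no representative to adjoin, but lies in `A` vacuously.
coset-bound k ih {A} sA Q h | false = begin
  3 ^ k * mass k Q        ≤⟨ *-monoʳ-≤ (3 ^ k) (mass-mono k Q⊆) ⟩
  3 ^ k * mass k A        ≤⟨ ih A sA ⟩
  dim A * total k         ≤⟨ m≤n+m _ (total k) ⟩
  suc (dim A) * total k   ∎
  where
  open ≤-Reasoning
  Q⊆ : Q ⊆ A
  Q⊆ x p with trans (sym eq) (nonempty-intro Q x p)
  ... | ()

-- ε = 1 when A is strictly larger than the sum of its axes, ε = 0 otherwise.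
combine : ∀ m M p₁ p₂ p₃ T P d₁ d₂ d₃ d ε →
  4 * P ≡ M * M * (p₁ + (p₂ + p₃)) + T →
  m * p₁ ≤ d₁ * M → m * p₂ ≤ d₂ * M → m * p₃ ≤ d₃ * M →
  m * T ≤ M * M * ((ε + d₁) * M) → m * T ≤ M * M * ((ε + d₂) * M) → m * T ≤ M * M * ((ε + d₃) * M) →
  3 * ε + 4 * (d₁ + (d₂ + d₃)) ≤ 4 * d →
  3 * m * P ≤ d * (M * (M * M))
combine m M p₁ p₂ p₃ T P d₁ d₂ d₃ d ε e h₁ h₂ h₃ t₁ t₂ t₃ le = *-cancelˡ-≤ 4 (begin
  4 * (3 * m * P)
    ≡⟨ pull m P ⟩
  3 * m * (4 * P)
    ≡⟨ cong (3 * m *_) e ⟩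
  3 * m * (M * M * (p₁ + (p₂ + p₃)) + T)
    ≡⟨ expand m M p₁ p₂ p₃ T ⟩
  -- The factor 3 of 3ᵏ⁺¹ supplies three copies of `T`, one for each of `t₁`, `t₂`, `t₃`.
  3 * (M * M * (m * p₁ + (m * p₂ + m * p₃))) + (m * T + (m * T + m * T))
    ≤⟨ +-mono-≤ (*-monoʳ-≤ 3 (*-monoʳ-≤ (M * M) (+-mono-≤ h₁ (+-mono-≤ h₂ h₃))))
                (+-mono-≤ t₁ (+-mono-≤ t₂ t₃)) ⟩
  3 * (M * M * (d₁ * M + (d₂ * M + d₃ * M))) +
    (M * M * ((ε + d₁) * M) + (M * M * ((ε + d₂) * M) + M * M * ((ε + d₃) * M)))
    ≡⟨ collect M d₁ d₂ d₃ ε ⟩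
  (3 * ε + 4 * (d₁ + (d₂ + d₃))) * (M * (M * M))
    ≤⟨ *-monoˡ-≤ (M * (M * M)) le ⟩
  4 * d * (M * (M * M))
    ≡⟨ *-assoc 4 d (M * (M * M)) ⟩
  4 * (d * (M * (M * M))) ∎)
  where
  open ≤-Reasoning
  pull : ∀ m P → 4 * (3 * m * P) ≡ 3 * m * (4 * P)
  pull = ℕ-Ring.solve-∀
  expand : ∀ m M p₁ p₂ p₃ T → 3 * m * (M * M * (p₁ + (p₂ + p₃)) + T) ≡
    3 * (M * M * (m * p₁ + (m * p₂ + m * p₃))) + (m * T + (m * T + m * T))
  expand = ℕ-Ring.solve-∀
  collect : ∀ M d₁ d₂ d₃ ε → 3 * (M * M * (d₁ * M + (d₂ * M + d₃ * M))) +
    (M * M * ((ε + d₁) * M) + (M * M * ((ε + d₂) * M) + M * M * ((ε + d₃) * M))) ≡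
    (3 * ε + 4 * (d₁ + (d₂ + d₃))) * (M * (M * M))
  collect = ℕ-Ring.solve-∀

mass-bound : ∀ k → MassBound k
mass-bound zero A sA = base (A (false ∷ [])) (A (true ∷ []))
  where
  -- On one bit the energy is 0 at bit 0 and 4, which is `total 0`, at bit 1.
  base : ∀ a b → 1 * (⟦ a ⟧ * 0 + ⟦ b ⟧ * 4) ≤ (⟦ b ⟧ + 0) * 4
  base false false = ≤-refl
  base false true  = ≤-refl
  base true  false = ≤-refl
  base true  true  = ≤-refl
mass-bound (suc k) A sA = subst (λ t → 3 * m * mass (suc k) A ≤ dim A * t) (sym (total-suc k))
  ([ strict , direct ]′ axesDim-dichotomy)
  where
  open Blocks {3 ^ k} A sA
  m = 3 ^ k
  M = total k

  T : ℕ
  T = tripleMass k (λ x y z → A (join x y z))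

  T-bound₁ : ∀ c → (∀ y z → m * mass k (λ x → A (join x y z)) ≤ c) → m * T ≤ M * M * c
  T-bound₁ c h = subst (λ t → m * t ≤ M * M * c)
    (sym (trans (tripleMass-swap₁₂ k (λ x y z → A (join x y z)))
               (tripleMass-swap₂₃ k (λ y x z → A (join x y z)))))
    (tripleMass-bound k (λ y z x → A (join x y z)) m c h)

  T-bound₂ : ∀ c → (∀ x z → m * mass k (λ y → A (join x y z)) ≤ c) → m * T ≤ M * M * c
  T-bound₂ c h = subst (λ t → m * t ≤ M * M * c) (sym (tripleMass-swap₂₃ k (λ x y z → A (join x y z))))
    (tripleMass-bound k (λ x z y → A (join x y z)) m c h)

  T-bound₃ : ∀ c → (∀ x y → m * mass k (λ z → A (join x y z)) ≤ c) → m * T ≤ M * M * c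
  T-bound₃ c h = tripleMass-bound k (λ x y z → A (join x y z)) m c h

  ih : MassBound k
  ih = mass-bound k

  finish : ∀ ε → m * T ≤ M * M * ((ε + dim axis₁) * M) → m * T ≤ M * M * ((ε + dim axis₂) * M) →
    m * T ≤ M * M * ((ε + dim axis₃) * M) → 3 * ε + 4 * axesDim ≤ 4 * dim A →
    3 * m * mass (suc k) A ≤ dim A * (M * (M * M))
  finish ε = combine m M (mass k axis₁) (mass k axis₂) (mass k axis₃) T (mass (suc k) A)
    (dim axis₁) (dim axis₂) (dim axis₃) (dim A) ε (mass-join k A)
    (ih axis₁ axis₁-isSubspace) (ih axis₂ axis₂-isSubspace) (ih axis₃ axis₃-isSubspace)

  strict : axesDim < dim A → 3 * m * mass (suc k) A ≤ dim A * (M * (M * M))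
  strict lt = finish 1
    (T-bound₁ _ λ y z → coset-bound k ih axis₁-isSubspace _ (slice₁ y z))
    (T-bound₂ _ λ x z → coset-bound k ih axis₂-isSubspace _ (slice₂ x z))
    (T-bound₃ _ λ x y → coset-bound k ih axis₃-isSubspace _ (slice₃ x y))
    -- The three fibre bounds exceed the axis dimensions by one each, costing 3, while strictness
    -- gains 4.
    (begin
      3 + 4 * axesDim   ≤⟨ +-monoˡ-≤ (4 * axesDim) (n≤1+n 3) ⟩
      4 + 4 * axesDim   ≡⟨ sym (*-suc 4 axesDim) ⟩
      4 * suc axesDim   ≤⟨ *-monoʳ-≤ 4 lt ⟩
      4 * dim A         ∎)
    where open ≤-Reasoning

  direct : axesDim ≤ dim A × IsDirectSum → 3 * m * mass (suc k) A ≤ dim A * (M * (M * M))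
  -- Each fibre now lies in the axis itself, so the induction hypothesis applies without adjoining a
  -- vector.
  direct (le , split) = finish 0
    (T-bound₁ _ λ y z → ≤-trans
      (*-monoʳ-≤ m (mass-mono k λ x p → proj₁ (split x y z p))) (ih axis₁ axis₁-isSubspace))
    (T-bound₂ _ λ x z → ≤-trans
      (*-monoʳ-≤ m (mass-mono k λ y p → proj₁ (proj₂ (split x y z p)))) (ih axis₂ axis₂-isSubspace))
    (T-bound₃ _ λ x y → ≤-trans
      (*-monoʳ-≤ m (mass-mono k λ z p → proj₂ (proj₂ (split x y z p)))) (ih axis₃ axis₃-isSubspace))
    (*-monoʳ-≤ 4 le)

-- Passage to ℚ

sumℤ-concatMap : ∀ {n} (f : F2^ (suc n) → ℤ) (l : List (F2^ n)) →
  sumℤ (map f (concatMap (λ v → (false ∷ v) ∷ (true ∷ v) ∷ []) l)) ≡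
  sumℤ (map (f ∘ (false ∷_)) l) ℤ.+ sumℤ (map (f ∘ (true ∷_)) l)
sumℤ-concatMap f []      = refl
sumℤ-concatMap f (v ∷ l) = trans
  (cong (λ t → f (false ∷ v) ℤ.+ (f (true ∷ v) ℤ.+ t)) (sumℤ-concatMap f l))
  (rearrange (f (false ∷ v)) (f (true ∷ v)) _ _)
  where
  rearrange : ∀ a b c d → a ℤ.+ (b ℤ.+ (c ℤ.+ d)) ≡ (a ℤ.+ c) ℤ.+ (b ℤ.+ d)
  rearrange = ℤ-Ring.solve-∀

sumℤ-allVecs : ∀ {n} (f : F2^ n → ℤ) → sumℤ (map f (allVecs n)) ≡ Σℤ.sum f
sumℤ-allVecs {zero}  f = ℤ.+-identityʳ (f [])
sumℤ-allVecs {suc n} f = trans (sumℤ-concatMap f (allVecs n))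
  (cong₂ ℤ._+_ (sumℤ-allVecs (f ∘ (false ∷_))) (sumℤ-allVecs (f ∘ (true ∷_))))

sum-pos : ∀ {n} (f : F2^ n → ℕ) → Σℤ.sum (λ x → + f x) ≡ + Σℕ.sum f
sum-pos {zero}  f = refl
sum-pos {suc n} f = cong₂ ℤ._+_ (sum-pos (f ∘ (false ∷_))) (sum-pos (f ∘ (true ∷_)))

-- ℚ reduces fractions; in ℚᵘ, up to `≃`, the common denominator can be kept.
toℚᵘ-/ : ∀ i q .{{_ : NonZero q}} → toℚᵘ (i ℚ./ q) ℚᵘ.≃ i ℚᵘ./ q
toℚᵘ-/ i (suc q) = ℚ.toℚᵘ-fromℚᵘ (ℚᵘ.mkℚᵘ i q)

/-≤-/ : ∀ a b p q .{{_ : NonZero p}} .{{_ : NonZero q}} →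
  a * q ≤ b * p → + a ℚᵘ./ p ℚᵘ.≤ + b ℚᵘ./ q
/-≤-/ a b (suc p) (suc q) le =
  ℚᵘ.*≤* (subst₂ ℤ._≤_ (ℤ.pos-* a (suc q)) (ℤ.pos-* b (suc p)) (ℤ.+≤+ le))

toℚᵘ-square : ∀ i q .{{_ : NonZero q}} .{{_ : NonZero (q * q)}} →
  toℚᵘ ((i ℚ./ q) ℚ.* (i ℚ./ q)) ℚᵘ.≃ (i ℤ.* i) ℚᵘ./ (q * q)
toℚᵘ-square i q@(suc _) = ℚᵘ.≃-trans (ℚ.toℚᵘ-homo-* (i ℚ./ q) (i ℚ./ q))
  (ℚᵘ.*-cong (toℚᵘ-/ i q) (toℚᵘ-/ i q))

/-+-/ : ∀ i j q .{{_ : NonZero q}} → i ℚᵘ./ q ℚᵘ.+ j ℚᵘ./ q ℚᵘ.≃ (i ℤ.+ j) ℚᵘ./ q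
/-+-/ i j q@(suc _) = ℚᵘ.*≡* (trans (rearrange i j (+ q))
  (cong ((i ℤ.+ j) ℤ.*_) (sym (ℤ.pos-* q q))))
  where
  rearrange : ∀ i j D → (i ℤ.* D ℤ.+ j ℤ.* D) ℤ.* D ≡ (i ℤ.+ j) ℤ.* (D ℤ.* D)
  rearrange = ℤ-Ring.solve-∀

-- Filtering by `A` becomes multiplication by its indicator, the form used in `mass`.
toℚᵘ-sum-squares : ∀ {n} (A : Sub n) (F : F2^ n → ℤ) q .{{_ : NonZero q}} .{{_ : NonZero (q * q)}}
  (l : List (F2^ n)) →
  toℚᵘ (sumℚ (map (λ S → (F S ℚ./ q) ℚ.* (F S ℚ./ q)) (filter (λ S → T? (A S)) l))) ℚᵘ.≃
  sumℤ (map (λ S → + ⟦ A S ⟧ ℤ.* (F S ℤ.* F S)) l) ℚᵘ./ (q * q)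
toℚᵘ-sum-squares A F (suc _) [] = ℚᵘ.*≡* refl
toℚᵘ-sum-squares A F q (S ∷ l) with A S
... | false = ℚᵘ.≃-trans (toℚᵘ-sum-squares A F q l)
  (ℚᵘ.≃-reflexive (ℚᵘ./-cong (sym (ℤ.+-identityˡ _)) refl))
... | true = ℚᵘ.≃-trans (ℚ.toℚᵘ-homo-+ ((F S ℚ./ q) ℚ.* (F S ℚ./ q)) _)
  (ℚᵘ.≃-trans (ℚᵘ.+-cong (toℚᵘ-square (F S) q) (toℚᵘ-sum-squares A F q l))
    (ℚᵘ.≃-trans (/-+-/ (F S ℤ.* F S) (sumℤ (map (λ S → + ⟦ A S ⟧ ℤ.* (F S ℤ.* F S)) l)) (q * q))
      (ℚᵘ.≃-reflexive (ℚᵘ./-cong (cong (ℤ._+ _) (sym (ℤ.*-identityˡ (F S ℤ.* F S)))) refl))))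

weightOn≃mass : ∀ k (A : Sub (3 ^ k)) .{{_ : NonZero (total k)}} →
  toℚᵘ (weightOn (MajK k) A) ℚᵘ.≃ + mass k A ℚᵘ./ total k
weightOn≃mass k A = ℚᵘ.≃-trans
  (toℚᵘ-sum-squares A F (2 ^ (3 ^ k)) {{m^n≢0 2 (3 ^ k)}} (allVecs (3 ^ k)))
  (ℚᵘ.≃-reflexive (ℚᵘ./-cong numerator refl))
  where
  F : F2^ (3 ^ k) → ℤ
  F S = sumℤ (map (λ x → MajK k x ℤ.* χ S x) (allVecs (3 ^ k)))

  term : ∀ S → + ⟦ A S ⟧ ℤ.* (F S ℤ.* F S) ≡ + (⟦ A S ⟧ * energy k S)
  term S = trans
    (cong (+ ⟦ A S ⟧ ℤ.*_) (trans (cong (λ i → i ℤ.* i) (sumℤ-allVecs {3 ^ k} _)) (coeff²≡energy k S)))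
    (sym (ℤ.pos-* ⟦ A S ⟧ (energy k S)))

  numerator : sumℤ (map (λ S → + ⟦ A S ⟧ ℤ.* (F S ℤ.* F S)) (allVecs (3 ^ k))) ≡ + mass k A
  numerator = trans (cong sumℤ (map-cong term (allVecs (3 ^ k))))
    (trans (sumℤ-allVecs {3 ^ k} _) (sum-pos {3 ^ k} _))

theorem4p2 : (k : ℕ) → 1 ≤ k → (d : ℕ) → d ≤ 3 ^ k →
    (A : F2^ (3 ^ k) → Bool) → IsSubspace A → HasDim A d →
    weightOn (MajK k) A ℚ.≤ bound k d
theorem4p2 k _ d _ A sA hasDim = ℚ.toℚᵘ-cancel-≤
  (ℚᵘ.≤-respˡ-≃ (ℚᵘ.≃-sym (weightOn≃mass k A))
    (ℚᵘ.≤-respʳ-≃ (ℚᵘ.≃-sym (toℚᵘ-/ (+ (4 * d)) (3 ^ k)))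
      (/-≤-/ (mass k A) (4 * d) (total k) (3 ^ k) cleared)))
  where
  instance
    total≢0 : NonZero (total k)
    total≢0 = m*n≢0 (2 ^ (3 ^ k)) (2 ^ (3 ^ k)) {{m^n≢0 2 (3 ^ k)}} {{m^n≢0 2 (3 ^ k)}}

    3^k≢0 : NonZero (3 ^ k)
    3^k≢0 = m^n≢0 3 k

  open ≤-Reasoning
  cleared : mass k A * 3 ^ k ≤ 4 * d * total k
  cleared = begin
    mass k A * 3 ^ k   ≡⟨ *-comm (mass k A) (3 ^ k) ⟩
    3 ^ k * mass k A   ≤⟨ mass-bound k A sA ⟩
    dim A * total k    ≤⟨ *-monoˡ-≤ (total k) (HasDim⇒dim≤ A hasDim) ⟩
    -- The bound d / 3ᵏ is reached here; the factor 4 of the claim is slack.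
    d * total k        ≤⟨ *-monoˡ-≤ (total k) (m≤m+n d (3 * d)) ⟩
    4 * d * total k    ∎
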